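{- For every $n\ge 3$, the strong metric dimension of the convex polytope graph $S_n$ satisfies $sdim(S_n)=n$ if $n$ is odd and $sdim(S_n)=\frac{3n}{2}$ if $n$ is even.
   Context: For $n\ge 3$, $S_n$ is the graph with vertex set $\{a_i,b_i,c_i,d_i : 1\le i\le n\}$ and edge set $\{a_ia_{i+1}, b_ib_{i+1}, c_ic_{i+1}, d_id_{i+1}, a_{i+1}b_i, a_ib_i, b_ic_i, c_id_i : 1\le i\le n\}$, indices taken modulo $n$. $d(u,v)$ is the graph distance. A vertex $w$ strongly resolves distinct vertices $u,v$ if $d(v,w)=d(v,u)+d(u,w)$ or $d(u,w)=d(u,v)+d(v,w)$. A set $S$ of vertices is a strong resolving set if every two distinct vertices are strongly resolved by some vertex of $S$; $sdim(G)$ is the minimum cardinality of a strong resolving set of $G$. -}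

module Defs where

open import Data.Fin using (Fin; toℕ)
open import Data.Fin.Properties using (toℕ<n; toℕ-fromℕ<)
open import Data.List using (List; length)
open import Data.List.Membership.Propositional using (_∈_)
open import Data.List.Relation.Unary.Unique.Propositional using (Unique)
open import Data.Nat using (ℕ; suc; _+_; _≤_; _<_; s≤s)
open import Data.Nat.DivMod using (_mod_; _%_; m%n<n; m<n⇒m%n≡m; n%n≡0)
open import Data.Nat.Properties using (m≤n⇒m<n∨m≡n; suc-injective; 1+n≢n)
open import Data.Product using (Σ-syntax; ∃-syntax; _×_)
open import Data.Sum using (_⊎_; inj₁; inj₂)
open import Level using (0ℓ)
open import Relation.Binary.Core using (Rel)
open import Relation.Binary.Construct.Closure.Symmetric using (SymClosure; fwd; bwd; symmetric)
open import Relation.Binary.Definitions using (Symmetric)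
open import Relation.Binary.PropositionalEquality using (_≡_; _≢_; refl; sym; trans; cong)
open import Relation.Nullary using (¬_)

record SimpleGraph : Set₁ where
  field
    Vertex : Set
    Adj    : Rel Vertex 0ℓ
    adj-sym    : Symmetric Adj
    adj-irrefl : ∀ {v} → ¬ Adj v v

module _ (G : SimpleGraph) where
  open SimpleGraph G

  data Walk : Vertex → Vertex → ℕ → Set where
    []  : ∀ {u} → Walk u u 0
    _∷_ : ∀ {u v w k} → Adj u v → Walk v w k → Walk u w (suc k)

  -- IsDist u v k is "d(u,v) = k"; no k satisfies it when u and v lie in
  -- different components.
  IsDist : Vertex → Vertex → ℕ → Set
  IsDist u v k = Walk u v k × (∀ m → Walk u v m → k ≤ m)

  -- OnGeodesic x y z is "d(x,z) = d(x,y) + d(y,z)".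
  OnGeodesic : Vertex → Vertex → Vertex → Set
  OnGeodesic x y z =
    ∃[ xz ] ∃[ xy ] ∃[ yz ]
      (IsDist x z xz × IsDist x y xy × IsDist y z yz × xz ≡ xy + yz)

  StronglyResolves : Vertex → Vertex → Vertex → Set
  StronglyResolves w u v = OnGeodesic v u w ⊎ OnGeodesic u v w

  IsStrongResolvingSet : List Vertex → Set
  IsStrongResolvingSet S =
    ∀ u v → u ≢ v → ∃[ w ] (w ∈ S × StronglyResolves w u v)

  -- IsSdim k is "sdim(G) = k".  Finite vertex sets are duplicate-free lists,
  -- so that length is cardinality.
  IsSdim : ℕ → Set
  IsSdim k =
    (Σ[ S ∈ List Vertex ] (Unique S × IsStrongResolvingSet S × length S ≡ k))
    × (∀ S → Unique S → IsStrongResolvingSet S → k ≤ length S)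

-- i + 1 modulo n; the indices 1, …, n are represented by the residues
-- 0, …, n - 1.
next : ∀ {n} → Fin n → Fin n
next {suc m} i = suc (toℕ i) mod suc m

data SVertex (n : ℕ) : Set where
  a b c d : Fin n → SVertex n

data SEdge {n : ℕ} : SVertex n → SVertex n → Set where
  aa  : ∀ i → SEdge (a i) (a (next i))
  bb  : ∀ i → SEdge (b i) (b (next i))
  cc  : ∀ i → SEdge (c i) (c (next i))
  dd  : ∀ i → SEdge (d i) (d (next i))
  a⁺b : ∀ i → SEdge (a (next i)) (b i)
  ab  : ∀ i → SEdge (a i) (b i)
  bc  : ∀ i → SEdge (b i) (c i)
  cd  : ∀ i → SEdge (c i) (d i)

next≢ : ∀ {n} → 3 ≤ n → (i : Fin n) → i ≢ next i
next≢ {suc m} (s≤s 2≤m) i i≡next = helper (m≤n⇒m<n∨m≡n (toℕ<n i))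
  where
  i≡1+i% : toℕ i ≡ suc (toℕ i) % suc m
  i≡1+i% = trans (cong toℕ i≡next) (toℕ-fromℕ< (m%n<n (suc (toℕ i)) (suc m)))

  zero-case : ∀ {k l} → 2 ≤ l → k ≡ 0 → ¬ (k ≡ l)
  zero-case () refl refl

  helper : ¬ (suc (toℕ i) < suc m ⊎ suc (toℕ i) ≡ suc m)
  helper (inj₁ lt) = 1+n≢n (sym (trans i≡1+i% (m<n⇒m%n≡m lt)))
  helper (inj₂ eq) =
    zero-case 2≤m
      (trans i≡1+i% (trans (cong (_% suc m) eq) (n%n≡0 (suc m))))
      (suc-injective eq)

SEdge-ends-≢ : ∀ {n} → 3 ≤ n → {u v : SVertex n} → SEdge u v → u ≢ v
SEdge-ends-≢ n≥3 (aa i) eq = next≢ n≥3 i (a-inj eq)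
  where a-inj : ∀ {i j} → a i ≡ a j → i ≡ j
        a-inj refl = refl
SEdge-ends-≢ n≥3 (bb i) eq = next≢ n≥3 i (b-inj eq)
  where b-inj : ∀ {i j} → b i ≡ b j → i ≡ j
        b-inj refl = refl
SEdge-ends-≢ n≥3 (cc i) eq = next≢ n≥3 i (c-inj eq)
  where c-inj : ∀ {i j} → c i ≡ c j → i ≡ j
        c-inj refl = refl
SEdge-ends-≢ n≥3 (dd i) eq = next≢ n≥3 i (d-inj eq)
  where d-inj : ∀ {i j} → d i ≡ d j → i ≡ j
        d-inj refl = refl
SEdge-ends-≢ n≥3 (a⁺b i) ()
SEdge-ends-≢ n≥3 (ab i) ()
SEdge-ends-≢ n≥3 (bc i) ()
SEdge-ends-≢ n≥3 (cd i) ()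

SAdj-irrefl : ∀ {n} → 3 ≤ n → {v : SVertex n} → ¬ SymClosure SEdge v v
SAdj-irrefl n≥3 (fwd e) = SEdge-ends-≢ n≥3 e refl
SAdj-irrefl n≥3 (bwd e) = SEdge-ends-≢ n≥3 e refl

S : (n : ℕ) → 3 ≤ n → SimpleGraph
S n n≥3 = record
  { Vertex     = SVertex n
  ; Adj        = SymClosure SEdge
  ; adj-sym    = symmetric SEdge
  ; adj-irrefl = SAdj-irrefl n≥3
  }

{-# OPTIONS --safe #-}

-- The distance from any vertex to d_j, and between two a's, is an explicit
-- function of the cyclic offset from the index of the first to that of the
-- second.  Order the layers a, b, c, d from outside in.  If v = b_j, c_j or d_j and
-- u lies in the same or an outer layer, some geodesic from u to d_j passes through
-- v; likewise, in one of the two orders, for two a's that are not antipodal.  So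
-- the d's resolve everything but antipodal pairs of a's, and those are covered by
-- half of the a's.  Conversely, a pair u, v such that no neighbour of either is
-- farther from the other can only be resolved by u or v itself.  For odd
-- n = 2k + 1 the pairs {a_i, d_{i+k}} are n disjoint such pairs; for even n = 2k the
-- pairs {b_i, d_{i+k}} and {a_i, a_{i+k}} are n + k of them.
module Submission where

open import Defs
open import Data.Fin using (Fin; toℕ; fromℕ<; inject≤; join; splitAt)
open import Data.Fin.Properties using (toℕ<n; toℕ-fromℕ<; toℕ-injective; toℕ-inject≤; inject≤-injective; injective⇒≤; join-splitAt)
open import Data.List using (List; length; tabulate; _++_; lookup)
open import Data.List.Membership.Propositional using (_∈_)
open import Data.List.Membership.Propositional.Properties using (∈-tabulate⁺; ∈-tabulate⁻; ∈-++⁺ˡ; ∈-++⁺ʳ)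
open import Data.List.Properties using (length-tabulate; length-++)
open import Data.List.Relation.Unary.Any using (index)
open import Data.List.Relation.Unary.Any.Properties using (lookup-index)
open import Data.List.Relation.Unary.Unique.Propositional using (Unique)
open import Data.List.Relation.Unary.Unique.Propositional.Properties using (tabulate⁺; ++⁺)
open import Data.Nat using (ℕ; zero; suc; _+_; _*_; _∸_; _⊓_; _≤_; _<_; z≤n; s≤s; >-nonZero)
open import Data.Nat.DivMod using (_/_; _%_; m%n<n; m<n⇒m%n≡m; [m+n]%n≡m%n; %-distribˡ-+; m%n%n≡m%n; m*n/n≡m)
open import Data.Nat.Divisibility using (_∣_; divides)
open import Data.Nat.Properties
open import Data.Nat.Tactic.RingSolver using (solve-∀)
open import Data.Product using (∃-syntax; _×_; _,_; proj₁; proj₂)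
open import Data.Sum using (_⊎_; inj₁; inj₂)
open import Function using (_∘_)
open import Relation.Binary.Construct.Closure.Symmetric using (SymClosure; fwd; bwd)
open import Relation.Binary.Definitions using (tri<; tri≈; tri>)
open import Relation.Binary.PropositionalEquality using (_≡_; _≢_; refl; sym; trans; cong; cong₂; subst; module ≡-Reasoning)
open import Relation.Nullary using (¬_; contradiction; yes; no)

-- Walks, geodesics and mutually maximally distant pairs.

module GraphLemmas (G : SimpleGraph) where
  open SimpleGraph G

  infixr 5 _++ʷ_
  infixl 5 _∷ʳʷ_

  _++ʷ_ : ∀ {u v w p q} → Walk G u v p → Walk G v w q → Walk G u w (p + q)
  []       ++ʷ ys = ys
  (e ∷ xs) ++ʷ ys = e ∷ (xs ++ʷ ys)

  _∷ʳʷ_ : ∀ {u v w p} → Walk G u v p → Adj v w → Walk G u w (suc p)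
  []       ∷ʳʷ f = f ∷ []
  (e ∷ xs) ∷ʳʷ f = e ∷ (xs ∷ʳʷ f)

  reverseʷ : ∀ {u v p} → Walk G u v p → Walk G v u p
  reverseʷ []       = []
  reverseʷ (e ∷ xs) = reverseʷ xs ∷ʳʷ adj-sym e

  -- Each edge lowers `f` by at most one, and `f` ends at 0. The explicit distance formulas get
  -- their lower bounds from this.
  potential-≤ : (f : Vertex → ℕ) → (∀ {u v} → Adj u v → f u ≤ suc (f v)) →
    ∀ {u v p} → f v ≡ 0 → Walk G u v p → f u ≤ p
  potential-≤ f lip fv≡0 []       = ≤-reflexive fv≡0
  potential-≤ f lip fv≡0 (e ∷ xs) = ≤-trans (lip e) (s≤s (potential-≤ f lip fv≡0 xs))

  -- If either walk could be shortened, the concatenation would beat the distance from `x` to `z`.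
  -- The order `q + p` lets the sum reduce when `q` is a numeral, as it is at every use.
  walks⇒OnGeodesic : ∀ {x y z p q} → IsDist G x z (q + p) →
    Walk G x y p → Walk G y z q → OnGeodesic G x y z
  walks⇒OnGeodesic {p = p} {q} xz@(_ , min) xy yz =
    _ , _ , _ , xz , (xy , min-xy) , (yz , min-yz) , +-comm q p
    where
    min-xy : ∀ m → Walk G _ _ m → p ≤ m
    min-xy m xs = +-cancelˡ-≤ q p m (≤-trans (min _ (xs ++ʷ yz)) (≤-reflexive (+-comm m q)))
    min-yz : ∀ m → Walk G _ _ m → q ≤ m
    min-yz m ys = +-cancelʳ-≤ p q m (≤-trans (min _ (xy ++ʷ ys)) (≤-reflexive (+-comm p m)))

  Within : ℕ → Vertex → Vertex → Set
  Within L u v = ∃[ p ] (p ≤ L × Walk G u v p)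

  Within-sym : ∀ {L u v} → Within L u v → Within L v u
  Within-sym (p , p≤L , xs) = p , p≤L , reverseʷ xs

  -- If the geodesic from `u` to `w` began with an edge to `x`, reaching `x` from `v` within `L`
  -- steps and going on would be shorter than passing through `u`.
  geodesic-stops : ∀ {L u v w} → (∀ m → Walk G v u m → L ≤ m) →
    (∀ {x} → Adj u x → Within L v x) → OnGeodesic G v u w → w ≡ u
  geodesic-stops _ _ (_ , _ , _ , _ , _ , ([] , _) , _) = refl
  geodesic-stops {L} min near (_ , p , _ , (_ , vw-min) , (vu , _) , (_∷_ {k = q} e xs , _) , refl)
    with ℓ , ℓ≤L , ys ← near e =
    contradiction (vw-min _ (ys ++ʷ xs)) (<⇒≱ (begin-strict
      ℓ + q     ≤⟨ +-monoˡ-≤ q (≤-trans ℓ≤L (min _ vu)) ⟩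
      p + q     <⟨ +-monoʳ-< p (n<1+n q) ⟩
      p + suc q ∎))
    where open ≤-Reasoning

  -- One threshold `L` separates the two bounds, so `geodesic-stops` applies to both alternatives of
  -- strong resolution.
  mutually-maximally-distant : ∀ {L u v w} → (∀ m → Walk G u v m → L ≤ m) →
    (∀ {x} → Adj u x → Within L x v) → (∀ {y} → Adj v y → Within L u y) →
    StronglyResolves G w u v → w ≡ u ⊎ w ≡ v
  mutually-maximally-distant min nearᵘ nearᵛ (inj₁ g) =
    inj₁ (geodesic-stops (λ m → min m ∘ reverseʷ) (Within-sym ∘ nearᵘ) g)
  mutually-maximally-distant min nearᵘ nearᵛ (inj₂ g) = inj₂ (geodesic-stops min nearᵛ g)

-- Pigeonhole: two indices with the same `position` share an entry of `xs`, which disjointness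
-- forbids. With forced pairs as `P` this bounds every resolving set from below.
disjoint-hits⇒≤ : ∀ {A : Set} {k} (xs : List A) (P : Fin k → A → Set) →
  (∀ {i j x} → P i x → P j x → i ≡ j) → (∀ i → ∃[ x ] (x ∈ xs × P i x)) → k ≤ length xs
disjoint-hits⇒≤ xs P disjoint hit = injective⇒≤ {f = position} position-injective
  where
  position : Fin _ → Fin (length xs)
  position i = index (proj₁ (proj₂ (hit i)))

  at-position : ∀ i → P i (lookup xs (position i))
  at-position i = subst (P i) (lookup-index (proj₁ (proj₂ (hit i)))) (proj₂ (proj₂ (hit i)))

  position-injective : ∀ {i j} → position i ≡ position j → i ≡ j
  position-injective {i} {j} eq =
    disjoint (at-position i) (subst (P j ∘ lookup xs) (sym eq) (at-position j))

splitAt-injective : ∀ m {n} {i j : Fin (m + n)} → splitAt m i ≡ splitAt m j → i ≡ j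
splitAt-injective m {n} {i} {j} eq =
  trans (sym (join-splitAt m n i)) (trans (cong (join m n) eq) (join-splitAt m n j))

k+k≡2k : ∀ k → k + k ≡ 2 * k
k+k≡2k k = cong (k +_) (sym (+-identityʳ k))

-- Cyclic distances

-- Either `t` is at most `p`, or taking at least `p + 1` from at most `2p + 1` leaves at most `p`.
⊓-∸-bound : ∀ {s} p t → s ≤ suc (p + p) → t ⊓ (s ∸ t) ≤ p
⊓-∸-bound {s} p t s≤ with t ≤? p
... | yes t≤p = ≤-trans (m⊓n≤m t _) t≤p
... | no  t≰p = ≤-trans (m⊓n≤n t _) (begin
  s ∸ t               ≤⟨ ∸-mono s≤ (≰⇒> t≰p) ⟩
  suc (p + p) ∸ suc p ≡⟨ m+n∸n≡m p p ⟩
  p                   ∎)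
  where open ≤-Reasoning

Near : ℕ → ℕ → Set
Near x y = x ≤ suc y × y ≤ suc x

Near-refl : ∀ x → Near x x
Near-refl x = n≤1+n x , n≤1+n x

Near-sym : ∀ {x y} → Near x y → Near y x
Near-sym (p , q) = q , p

Near-suc : ∀ x → Near (suc x) x
Near-suc x = ≤-refl , ≤-trans (n≤1+n x) (n≤1+n _)

Near-pred : ∀ x → Near x (x ∸ 1)
Near-pred zero    = Near-refl 0
Near-pred (suc x) = Near-suc x

Near-∸ : ∀ s t → Near (suc s ∸ t) (s ∸ t)
Near-∸ s       zero    = Near-suc s
Near-∸ zero    (suc t) = subst (λ z → Near z 0) (sym (0∸n≡0 t)) (Near-refl 0)
Near-∸ (suc s) (suc t) = Near-∸ s t

Near-∸-suc : ∀ s t → Near (s ∸ suc t) (s ∸ t)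
Near-∸-suc zero    t = subst (Near 0) (sym (0∸n≡0 t)) (Near-refl 0)
Near-∸-suc (suc s) t = Near-sym (Near-∸ s t)

Near-⊓ : ∀ {x x′ y y′} → Near x x′ → Near y y′ → Near (x ⊓ y) (x′ ⊓ y′)
Near-⊓ (p , q) (p′ , q′) = ⊓-mono-≤ p p′ , ⊓-mono-≤ q q′

Near-+ : ∀ k {x y} → Near x y → Near (k + x) (k + y)
Near-+ zero    p = p
Near-+ (suc k) p with q , r ← Near-+ k p = s≤s q , s≤s r

Near-0 : ∀ {x} → x ≤ 1 → Near 0 x
Near-0 x≤1 = z≤n , x≤1

Near-suc-between : ∀ {x y} → x ≤ y → y ≤ suc x → Near (suc x) y
Near-suc-between x≤y y≤1+x = s≤s x≤y , m≤n⇒m≤1+n y≤1+x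

suc∸≤suc : ∀ s t → suc s ∸ t ≤ suc (s ∸ t)
suc∸≤suc s t = proj₁ (Near-∸ s t)

-- Rotations and offsets on the index cycle.

module Polytope (m : ℕ) (n≥3 : 3 ≤ suc m) where

  n : ℕ
  n = suc m

  G : SimpleGraph
  G = S n n≥3

  open GraphLemmas G

  toℕ-next : (i : Fin n) → toℕ (next i) ≡ suc (toℕ i) % n
  toℕ-next i = toℕ-fromℕ< (m%n<n (suc (toℕ i)) n)

  -- `next` is applied first, so that a walk starting with the edge out of `i` ends at
  -- `rotate (suc t) i` definitionally.
  rotate : ℕ → Fin n → Fin n
  rotate zero    i = i
  rotate (suc t) i = rotate t (next i)

  %-absorbˡ : ∀ x y → (x % n + y) % n ≡ (x + y) % n
  %-absorbˡ x y = begin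
    (x % n + y) % n             ≡⟨ %-distribˡ-+ (x % n) y n ⟩
    (x % n % n + y % n) % n     ≡⟨ cong (λ z → (z + y % n) % n) (m%n%n≡m%n x n) ⟩
    (x % n + y % n) % n         ≡⟨ sym (%-distribˡ-+ x y n) ⟩
    (x + y) % n                 ∎
    where open ≡-Reasoning

  toℕ-% : (i : Fin n) → toℕ i % n ≡ toℕ i
  toℕ-% i = m<n⇒m%n≡m (toℕ<n i)

  toℕ-rotate : ∀ t i → toℕ (rotate t i) ≡ (toℕ i + t) % n
  toℕ-rotate zero    i = sym (trans (cong (_% n) (+-identityʳ (toℕ i))) (toℕ-% i))
  toℕ-rotate (suc t) i = begin
    toℕ (rotate t (next i))     ≡⟨ toℕ-rotate t (next i) ⟩
    (toℕ (next i) + t) % n      ≡⟨ cong (λ z → (z + t) % n) (toℕ-next i) ⟩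
    (suc (toℕ i) % n + t) % n   ≡⟨ %-absorbˡ (suc (toℕ i)) t ⟩
    (suc (toℕ i) + t) % n       ≡⟨ cong (_% n) (sym (+-suc (toℕ i) t)) ⟩
    (toℕ i + suc t) % n         ∎
    where open ≡-Reasoning

  rotate-+ : ∀ s t i → rotate t (rotate s i) ≡ rotate (s + t) i
  rotate-+ zero    t i = refl
  rotate-+ (suc s) t i = rotate-+ s t (next i)

  rotate-full : ∀ i → rotate n i ≡ i
  rotate-full i = toℕ-injective (trans (toℕ-rotate n i) (trans ([m+n]%n≡m%n (toℕ i) n) (toℕ-% i)))

  rotate-back : ∀ {t} i → t ≤ n → rotate (n ∸ t) (rotate t i) ≡ i
  rotate-back {t} i t≤n =
    trans (rotate-+ t (n ∸ t) i) (trans (cong (λ z → rotate z i) (m+[n∸m]≡n t≤n)) (rotate-full i))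

  rotate-injective : ∀ {t i j} → t ≤ n → rotate t i ≡ rotate t j → i ≡ j
  rotate-injective {t} {i} {j} t≤n eq =
    trans (sym (rotate-back i t≤n)) (trans (cong (rotate (n ∸ t)) eq) (rotate-back j t≤n))

  -- The `t < n` with `rotate t i ≡ j`; `n ∸ toℕ i` stands for minus `i` modulo `n`.
  offset : Fin n → Fin n → ℕ
  offset i j = (toℕ j + (n ∸ toℕ i)) % n

  offset<n : ∀ i j → offset i j < n
  offset<n i j = m%n<n (toℕ j + (n ∸ toℕ i)) n

  offset≤n : ∀ i j → offset i j ≤ n
  offset≤n i j = <⇒≤ (offset<n i j)

  +-around : ∀ (i : Fin n) x → ((toℕ i + x) + (n ∸ toℕ i)) % n ≡ x % n
  +-around i x = begin
    ((toℕ i + x) + (n ∸ toℕ i)) % n ≡⟨ cong (λ z → (z + (n ∸ toℕ i)) % n) (+-comm (toℕ i) x) ⟩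
    ((x + toℕ i) + (n ∸ toℕ i)) % n ≡⟨ cong (_% n) (+-assoc x (toℕ i) (n ∸ toℕ i)) ⟩
    (x + (toℕ i + (n ∸ toℕ i))) % n ≡⟨ cong (λ z → (x + z) % n) (m+[n∸m]≡n (<⇒≤ (toℕ<n i))) ⟩
    (x + n) % n                     ≡⟨ [m+n]%n≡m%n x n ⟩
    x % n                           ∎
    where open ≡-Reasoning

  offset-rotate : ∀ {t} i → t < n → offset i (rotate t i) ≡ t
  offset-rotate {t} i t<n = begin
    (toℕ (rotate t i) + (n ∸ toℕ i)) % n      ≡⟨ cong (λ z → (z + (n ∸ toℕ i)) % n) (toℕ-rotate t i) ⟩
    ((toℕ i + t) % n + (n ∸ toℕ i)) % n       ≡⟨ %-absorbˡ (toℕ i + t) (n ∸ toℕ i) ⟩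
    ((toℕ i + t) + (n ∸ toℕ i)) % n           ≡⟨ +-around i t ⟩
    t % n                                     ≡⟨ m<n⇒m%n≡m t<n ⟩
    t                                         ∎
    where open ≡-Reasoning

  rotate-offset : ∀ i j → rotate (offset i j) i ≡ j
  rotate-offset i j = toℕ-injective (begin
    toℕ (rotate (offset i j) i)                  ≡⟨ toℕ-rotate (offset i j) i ⟩
    (toℕ i + offset i j) % n                     ≡⟨ cong (_% n) (+-comm (toℕ i) (offset i j)) ⟩
    (offset i j + toℕ i) % n                     ≡⟨ %-absorbˡ (toℕ j + (n ∸ toℕ i)) (toℕ i) ⟩
    ((toℕ j + (n ∸ toℕ i)) + toℕ i) % n          ≡⟨ cong (_% n) (+-comm (toℕ j + (n ∸ toℕ i)) (toℕ i)) ⟩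
    (toℕ i + (toℕ j + (n ∸ toℕ i))) % n          ≡⟨ cong (_% n) (sym (+-assoc (toℕ i) (toℕ j) _)) ⟩
    ((toℕ i + toℕ j) + (n ∸ toℕ i)) % n          ≡⟨ +-around i (toℕ j) ⟩
    toℕ j % n                                    ≡⟨ toℕ-% j ⟩
    toℕ j                                        ∎)
    where open ≡-Reasoning

  rotate-coffset : ∀ i j → rotate (n ∸ offset i j) j ≡ i
  rotate-coffset i j =
    trans (cong (rotate (n ∸ offset i j)) (sym (rotate-offset i j))) (rotate-back i (offset≤n i j))

  rotate⇒offset : ∀ {t i j} → t < n → rotate t i ≡ j → offset i j ≡ t
  rotate⇒offset {i = i} t<n refl = offset-rotate i t<n

  offset-self : ∀ i → offset i i ≡ 0
  offset-self i = offset-rotate i (s≤s z≤n)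

  0<offset : ∀ {i j} → i ≢ j → 0 < offset i j
  0<offset {i} {j} i≢j = n≢0⇒n>0 λ t≡0 → i≢j (trans (cong (λ t → rotate t i) (sym t≡0)) (rotate-offset i j))

  -- The rest of the turn leads from `j` back to `i`; distinctness keeps it below `n`.
  offset-sym : ∀ {i j} → i ≢ j → offset j i ≡ n ∸ offset i j
  offset-sym {i} {j} i≢j = rotate⇒offset (∸-monoʳ-< (0<offset i≢j) (offset≤n i j)) (rotate-coffset i j)

  -- The change of offset when the source moves to `next` and the target stays. It turns Lipschitz
  -- conditions on edges into arithmetic.
  data OffsetStep : ℕ → ℕ → Set where
    down : ∀ {t} → OffsetStep (suc t) t
    wrap : OffsetStep 0 m

  offset-next : ∀ i j → OffsetStep (offset i j) (offset (next i) j)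
  offset-next i j with offset i j | offset<n i j | rotate-offset i j
  ... | suc t | t<n | eq rewrite rotate⇒offset {i = next i} (<⇒≤ t<n) eq = down
  -- `rotate m (next i)` is `rotate n i`, a full turn.
  ... | zero  | _   | refl rewrite rotate⇒offset {i = next i} (n<1+n m) (rotate-full i) = wrap

  -- With t the offset from i to j: φ t is the distance from b_i to b_j, and
  -- 1 + ψ t the distance from a_i to b_j (through b_i or b_{i-1}).  χ t is
  -- min (φ t) (φ (t - 1)), extended by 0 at t = 0; it bounds the distance from
  -- b_i, c_i and d_i to a_j from below.
  φ ψ χ : ℕ → ℕ
  φ t = t ⊓ (n ∸ t)
  ψ t = t ⊓ (m ∸ t)
  χ t = (t ∸ 1) ⊓ (n ∸ t)

  n∸m≤1 : n ∸ m ≤ 1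
  n∸m≤1 = ≤-reflexive (m+n∸n≡m 1 m)

  φm≤1 : φ m ≤ 1
  φm≤1 = ≤-trans (m⊓n≤n m (n ∸ m)) n∸m≤1

  ψm≡0 : ψ m ≡ 0
  ψm≡0 = trans (cong (m ⊓_) (n∸n≡0 m)) (⊓-zeroʳ m)

  φ-step : ∀ {t t′} → OffsetStep t t′ → Near (φ t) (φ t′)
  φ-step {t′ = t} down = Near-⊓ (Near-suc t) (Near-sym (Near-∸ m t))
  φ-step wrap = Near-0 φm≤1

  ψ-step : ∀ {t t′} → OffsetStep t t′ → Near (ψ t) (ψ t′)
  ψ-step {t′ = t} down = Near-⊓ (Near-suc t) (Near-∸-suc m t)
  ψ-step wrap = Near-0 (≤-trans (≤-reflexive ψm≡0) z≤n)

  χ-step : ∀ {t t′} → OffsetStep t t′ → Near (χ t) (χ t′)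
  χ-step {t′ = t} down = Near-⊓ (Near-pred t) (Near-sym (Near-∸ m t))
  χ-step wrap = Near-0 (≤-trans (m⊓n≤n (m ∸ 1) (n ∸ m)) n∸m≤1)

  ψφ-near : ∀ t → Near (suc (ψ t)) (φ t)
  ψφ-near t = Near-suc-between
    (⊓-mono-≤ (≤-refl {t}) (∸-monoˡ-≤ t (n≤1+n m)))
    (⊓-mono-≤ (n≤1+n t) (suc∸≤suc m t))

  ψφ-step : ∀ {t t′} → OffsetStep t t′ → Near (suc (ψ t′)) (φ t)
  ψφ-step {t′ = t} down = Near-suc-between
    (⊓-mono-≤ (n≤1+n t) (≤-refl {m ∸ t}))
    (⊓-mono-≤ (≤-refl {suc t}) (n≤1+n (m ∸ t)))
  ψφ-step wrap rewrite ψm≡0 = Near-suc 0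

  φχ-step : ∀ {t t′} → OffsetStep t t′ → Near (φ t′) (χ t)
  φχ-step {t′ = t} down = Near-⊓ (Near-refl t) (Near-∸ m t)
  φχ-step wrap = Near-sym (Near-0 φm≤1)

  -- Potentials bounding distances from below.

  edges⇒lipschitz : (f : SVertex n → ℕ) → (∀ {u v} → SEdge u v → Near (f u) (f v)) →
    ∀ {u v} → SymClosure SEdge u v → f u ≤ suc (f v)
  edges⇒lipschitz f near (fwd e) = proj₁ (near e)
  edges⇒lipschitz f near (bwd e) = proj₂ (near e)

  toD : Fin n → SVertex n → ℕ
  toD j (a i) = 3 + ψ (offset i j)
  toD j (b i) = 2 + φ (offset i j)
  toD j (c i) = 1 + φ (offset i j)
  toD j (d i) = φ (offset i j)

  toD-edge : ∀ j {u v} → SEdge u v → Near (toD j u) (toD j v)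
  toD-edge j (aa i)  = Near-+ 3 (ψ-step (offset-next i j))
  toD-edge j (bb i)  = Near-+ 2 (φ-step (offset-next i j))
  toD-edge j (cc i)  = Near-+ 1 (φ-step (offset-next i j))
  toD-edge j (dd i)  = φ-step (offset-next i j)
  toD-edge j (a⁺b i) = Near-+ 2 (ψφ-step (offset-next i j))
  toD-edge j (ab i)  = Near-+ 2 (ψφ-near (offset i j))
  toD-edge j (bc i)  = Near-suc (suc (φ (offset i j)))
  toD-edge j (cd i)  = Near-suc (φ (offset i j))

  -- Only the values at the a's are exact, and only those are read off; the inner layers need just a
  -- Lipschitz extension.
  toA : Fin n → SVertex n → ℕ
  toA j (a i) = φ (offset i j)
  toA j (b i) = χ (offset i j)
  toA j (c i) = χ (offset i j)
  toA j (d i) = χ (offset i j)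

  toA-edge : ∀ j {u v} → SEdge u v → Near (toA j u) (toA j v)
  toA-edge j (aa i)  = φ-step (offset-next i j)
  toA-edge j (bb i)  = χ-step (offset-next i j)
  toA-edge j (cc i)  = χ-step (offset-next i j)
  toA-edge j (dd i)  = χ-step (offset-next i j)
  toA-edge j (a⁺b i) = φχ-step (offset-next i j)
  toA-edge j (ab i)  = Near-⊓ (Near-pred (offset i j)) (Near-refl (n ∸ offset i j))
  toA-edge j (bc i)  = Near-refl (χ (offset i j))
  toA-edge j (cd i)  = Near-refl (χ (offset i j))

  toD-≤ : ∀ {u j p} → Walk G u (d j) p → toD j u ≤ p
  toD-≤ {j = j} = potential-≤ (toD j) (edges⇒lipschitz (toD j) (toD-edge j)) (cong φ (offset-self j))

  toA-≤ : ∀ {u j p} → Walk G u (a j) p → toA j u ≤ p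
  toA-≤ {j = j} = potential-≤ (toA j) (edges⇒lipschitz (toA j) (toA-edge j)) (cong φ (offset-self j))

  -- Explicit walks attaining the bounds.

  module Cycle (x : Fin n → SVertex n) (edge : ∀ i → SEdge (x i) (x (next i))) where

    along : ∀ t i → Walk G (x i) (x (rotate t i)) t
    along zero    i = []
    along (suc t) i = fwd (edge i) ∷ along t (next i)

    ahead : ∀ i j → Walk G (x i) (x j) (offset i j)
    ahead i j = subst (λ z → Walk G (x i) (x z) (offset i j)) (rotate-offset i j) (along _ i)

    around : ∀ i j → Walk G (x i) (x j) (φ (offset i j))
    around i j with ⊓-sel (offset i j) (n ∸ offset i j)
    ... | inj₁ eq = subst (Walk G (x i) (x j)) (sym eq) (ahead i j)
    ... | inj₂ eq = subst (Walk G (x i) (x j)) (sym eq)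
      (reverseʷ (subst (λ z → Walk G (x j) (x z) (n ∸ offset i j)) (rotate-coffset i j) (along _ j)))

  module A = Cycle a aa
  module B = Cycle b bb
  module C = Cycle c cc
  module D = Cycle d dd

  next-rotate : ∀ t i → next (rotate t i) ≡ rotate (suc t) i
  next-rotate zero    i = refl
  next-rotate (suc t) i = next-rotate t (next i)

  a↝b : ∀ i j → Walk G (a i) (b j) (suc (ψ (offset i j)))
  a↝b i j with ⊓-sel (offset i j) (m ∸ offset i j)
  ... | inj₁ eq = subst (Walk G (a i) (b j) ∘ suc) (sym eq) (fwd (ab i) ∷ B.ahead i j)
  -- The other way round, built in reverse: `m ∸ offset i j` steps forward from `b j` reach the b of
  -- index `i - 1`, which is adjacent to `a i`.
  ... | inj₂ eq = subst (Walk G (a i) (b j) ∘ suc) (sym eq)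
    (reverseʷ (subst (λ z → Walk G (b j) (a z) (suc (m ∸ offset i j))) arrive
      (B.along (m ∸ offset i j) j ∷ʳʷ bwd (a⁺b (rotate (m ∸ offset i j) j)))))
    where
    arrive : next (rotate (m ∸ offset i j) j) ≡ i
    arrive = begin
      next (rotate (m ∸ offset i j) j) ≡⟨ next-rotate (m ∸ offset i j) j ⟩
      rotate (suc (m ∸ offset i j)) j  ≡⟨ cong (λ z → rotate z j) (sym (+-∸-assoc 1 (≤-pred (offset<n i j)))) ⟩
      rotate (n ∸ offset i j) j        ≡⟨ rotate-coffset i j ⟩
      i                                ∎
      where open ≡-Reasoning

  b↝d : ∀ j → Walk G (b j) (d j) 2
  b↝d j = fwd (bc j) ∷ (fwd (cd j) ∷ [])

  c↝d : ∀ j → Walk G (c j) (d j) 1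
  c↝d j = fwd (cd j) ∷ []

  b↝c : ∀ i j → Walk G (b i) (c j) (suc (φ (offset i j)))
  b↝c i j = B.around i j ∷ʳʷ fwd (bc j)

  a↝c : ∀ i j → Walk G (a i) (c j) (2 + ψ (offset i j))
  a↝c i j = a↝b i j ∷ʳʷ fwd (bc j)

  walk-to-d : ∀ u j → Walk G u (d j) (toD j u)
  walk-to-d (a i) j = a↝c i j ∷ʳʷ fwd (cd j)
  walk-to-d (b i) j = b↝c i j ∷ʳʷ fwd (cd j)
  walk-to-d (c i) j = C.around i j ∷ʳʷ fwd (cd j)
  walk-to-d (d i) j = D.around i j

  dist-to-d : ∀ u j → IsDist G u (d j) (toD j u)
  dist-to-d u j = walk-to-d u j , λ _ → toD-≤

  -- Resolving sets

  -- Below half a turn `ψ t` equals `t`, so going along the a's to `a j` and then straight down is a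
  -- geodesic.
  a-before-half : ∀ i j → offset i j + offset i j < n → OnGeodesic G (a i) (a j) (d j)
  a-before-half i j 2t<n = walks⇒OnGeodesic
    (subst (IsDist G (a i) (d j) ∘ (3 +_)) ψt≡t (dist-to-d (a i) j))
    (A.ahead i j) (fwd (ab j) ∷ b↝d j)
    where
    ψt≡t : ψ (offset i j) ≡ offset i j
    ψt≡t = m≤n⇒m⊓n≡m (m+n≤o⇒m≤o∸n (offset i j) (≤-pred 2t<n))

  Antipodal : SVertex n → SVertex n → Set
  Antipodal u v = ∃[ i ] ∃[ j ] (u ≡ a i × v ≡ a j × offset i j + offset i j ≡ n)

  a-pair : ∀ i j → i ≢ j →
    (∃[ w ] StronglyResolves G (d w) (a i) (a j)) ⊎ Antipodal (a i) (a j)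
  a-pair i j i≢j with <-cmp (offset i j + offset i j) n
  ... | tri< 2t<n _ _ = inj₁ (j , inj₂ (a-before-half i j 2t<n))
  ... | tri≈ _ 2t≡n _ = inj₂ (i , j , refl , refl , 2t≡n)
  -- Past half a turn the offset from `j` back to `i` is less than half, so the roles are exchanged.
  ... | tri> _ _ n<2t = inj₁ (i , inj₁ (a-before-half j i 2s<n))
    where
    2s<n : offset j i + offset j i < n
    2s<n rewrite offset-sym i≢j = begin-strict
      (n ∸ offset i j) + (n ∸ offset i j) <⟨ +-monoʳ-< (n ∸ offset i j) (m<n+o⇒m∸n<o n (offset i j) {{>-nonZero (0<offset i≢j)}} n<2t) ⟩
      (n ∸ offset i j) + offset i j       ≡⟨ m∸n+n≡m (offset≤n i j) ⟩
      n                                   ∎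
      where open ≤-Reasoning

  d-resolves : ∀ u v → u ≢ v → (∃[ w ] StronglyResolves G (d w) u v) ⊎ Antipodal u v
  d-resolves (a i) (a j) u≢v = a-pair i j (u≢v ∘ cong a)
  d-resolves (a i) (b j) _ = inj₁ (j , inj₂ (walks⇒OnGeodesic (dist-to-d (a i) j) (a↝b i j) (b↝d j)))
  d-resolves (a i) (c j) _ = inj₁ (j , inj₂ (walks⇒OnGeodesic (dist-to-d (a i) j) (a↝c i j) (c↝d j)))
  d-resolves (b i) (b j) _ = inj₁ (j , inj₂ (walks⇒OnGeodesic (dist-to-d (b i) j) (B.around i j) (b↝d j)))
  d-resolves (b i) (c j) _ = inj₁ (j , inj₂ (walks⇒OnGeodesic (dist-to-d (b i) j) (b↝c i j) (c↝d j)))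
  d-resolves (c i) (c j) _ = inj₁ (j , inj₂ (walks⇒OnGeodesic (dist-to-d (c i) j) (C.around i j) (c↝d j)))
  d-resolves (b i) (a j) _ = inj₁ (i , inj₁ (walks⇒OnGeodesic (dist-to-d (a j) i) (a↝b j i) (b↝d i)))
  d-resolves (c i) (a j) _ = inj₁ (i , inj₁ (walks⇒OnGeodesic (dist-to-d (a j) i) (a↝c j i) (c↝d i)))
  d-resolves (c i) (b j) _ = inj₁ (i , inj₁ (walks⇒OnGeodesic (dist-to-d (b j) i) (b↝c j i) (c↝d i)))
  -- A d resolves every pair containing it, by the empty walk.
  d-resolves (d i) v     _ = inj₁ (i , inj₁ (walks⇒OnGeodesic (dist-to-d v i) (walk-to-d v i) []))
  d-resolves u     (d j) _ = inj₁ (j , inj₂ (walks⇒OnGeodesic (dist-to-d u j) (walk-to-d u j) []))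

  a-injective : ∀ {i j : Fin n} → a i ≡ a j → i ≡ j
  a-injective refl = refl

  b-injective : ∀ {i j : Fin n} → b i ≡ b j → i ≡ j
  b-injective refl = refl

  d-injective : ∀ {i j : Fin n} → d i ≡ d j → i ≡ j
  d-injective refl = refl

  all-d : List (SVertex n)
  all-d = tabulate d

  all-d-unique : Unique all-d
  all-d-unique = tabulate⁺ d-injective

  -- Forced pairs

  module Forced {L : ℕ} (ψ-bound : ∀ t → 3 + ψ t ≤ L) (φ-bound : ∀ t → 2 + φ t ≤ L) where

    near-d : ∀ u j → Within L u (d j)
    near-d u j = toD j u , bound u , walk-to-d u j
      where
      bound : ∀ u → toD j u ≤ L
      bound (a i) = ψ-bound (offset i j)
      bound (b i) = φ-bound (offset i j)
      bound (c i) = ≤-trans (n≤1+n _) (φ-bound (offset i j))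
      bound (d i) = ≤-trans (m≤n+m _ 2) (φ-bound (offset i j))

    near-c : ∀ u j → Within L u (c j)
    near-c (a i) j = _ , ≤-trans (n≤1+n _) (ψ-bound (offset i j)) , a↝c i j
    near-c (b i) j = _ , ≤-trans (n≤1+n _) (φ-bound (offset i j)) , b↝c i j
    near-c (c i) j = _ , ≤-trans (m≤n+m _ 2) (φ-bound (offset i j)) , C.around i j
    near-c (d i) j = _ , ≤-trans (n≤1+n _) (φ-bound (offset i j)) , (D.around i j ∷ʳʷ bwd (cd j))

    near-neighbour : ∀ u {j y} → SymClosure SEdge (d j) y → Within L u y
    near-neighbour u (fwd (dd j)) = near-d u (next j)
    near-neighbour u (bwd (dd j)) = near-d u j
    near-neighbour u (bwd (cd j)) = near-c u j

    -- Every vertex is within `L` of all c's and d's, and a d has no other neighbours; distance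
    -- exactly `L` is therefore maximal at both ends.
    forced-d : ∀ {u j w} → toD j u ≡ L → StronglyResolves G w u (d j) → w ≡ u ⊎ w ≡ d j
    forced-d {u} {j} refl = mutually-maximally-distant (λ _ → toD-≤)
      (λ {x} _ → near-d x j) (near-neighbour u)

  -- Vertices of the inner layers may be farther than `L`; maximality concerns only neighbours of
  -- a's, which are a's and b's.
  module ForcedA {L : ℕ} (ψ-bound : ∀ t → 1 + ψ t ≤ L) (φ-bound : ∀ t → φ t ≤ L) where

    near-a : ∀ i j → Within L (a i) (a j)
    near-a i j = _ , φ-bound (offset i j) , A.around i j

    near-b : ∀ i j → Within L (a i) (b j)
    near-b i j = _ , ψ-bound (offset i j) , a↝b i j

    near-neighbour : ∀ i {j y} → SymClosure SEdge (a j) y → Within L (a i) y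
    near-neighbour i (fwd (aa j))  = near-a i (next j)
    near-neighbour i (bwd (aa j))  = near-a i j
    near-neighbour i (fwd (a⁺b j)) = near-b i j
    near-neighbour i (fwd (ab j))  = near-b i j

    forced-a : ∀ {i j w} → φ (offset i j) ≡ L → StronglyResolves G w (a i) (a j) → w ≡ a i ⊎ w ≡ a j
    forced-a {i} {j} refl = mutually-maximally-distant (λ _ → toA-≤)
      (Within-sym ∘ near-neighbour j) (near-neighbour i)

-- Odd `n = 2k + 1`.

module Odd (k : ℕ) (n≥3 : 3 ≤ suc (k + k)) where
  open Polytope (k + k) n≥3
  -- Here `φ` and `ψ` are both at most `k`, so only a's can reach distance `3 + k` from a d.
  open Forced {3 + k}
    (λ t → +-monoʳ-≤ 3 (⊓-∸-bound k t (n≤1+n (k + k))))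
    (λ t → ≤-trans (+-monoʳ-≤ 2 (⊓-∸-bound k t ≤-refl)) (n≤1+n (2 + k)))

  k<n : k < n
  k<n = s≤s (m≤m+n k k)

  resolving : IsStrongResolvingSet G all-d
  resolving u v u≢v with d-resolves u v u≢v
  ... | inj₁ (w , r) = d w , ∈-tabulate⁺ {f = d} w , r
  -- An antipodal pair would make `2k + 1` even.
  ... | inj₂ (i , j , _ , _ , 2t≡n) = contradiction 2t≡n λ eq →
    even≢odd (offset i j) k
      (trans (sym (k+k≡2k (offset i j))) (trans eq (cong suc (k+k≡2k k))))

  Pair : Fin n → SVertex n → Set
  Pair i x = x ≡ a i ⊎ x ≡ d (rotate k i)

  pairs-disjoint : ∀ {i j x} → Pair i x → Pair j x → i ≡ j
  pairs-disjoint (inj₁ refl) (inj₁ eq) = a-injective eq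
  pairs-disjoint (inj₂ refl) (inj₂ eq) = rotate-injective (<⇒≤ k<n) (d-injective eq)

  far : ∀ i → toD (rotate k i) (a i) ≡ 3 + k
  far i rewrite offset-rotate i k<n | m+n∸n≡m k k = cong (3 +_) (⊓-idem k)

  hit : ∀ {xs} → IsStrongResolvingSet G xs → ∀ i → ∃[ x ] (x ∈ xs × Pair i x)
  hit res i with w , w∈ , r ← res (a i) (d (rotate k i)) (λ ()) = w , w∈ , forced-d (far i) r

  sdim : IsSdim G n
  sdim = (all-d , all-d-unique , resolving , length-tabulate d)
       , λ xs _ res → disjoint-hits⇒≤ xs Pair pairs-disjoint (hit res)

-- Even `n = 2k`, with `k = h + 1`.

module Even (h : ℕ) (n≥3 : 3 ≤ suc h + suc h) where
  open Polytope (h + suc h) n≥3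

  open GraphLemmas G using (walks⇒OnGeodesic)

  k : ℕ
  k = suc h

  ψ-bound : ∀ t → ψ t ≤ h
  ψ-bound t = ⊓-∸-bound h t (≤-reflexive (+-suc h h))

  φ-bound : ∀ t → φ t ≤ k
  φ-bound t = ⊓-∸-bound k t (n≤1+n (k + k))

  -- Now `ψ` is at most `k - 1` while `φ` reaches `k`, so a's and b's have the same bound `2 + k`.
  open Forced {2 + k} (λ t → +-monoʳ-≤ 3 (ψ-bound t)) (λ t → +-monoʳ-≤ 2 (φ-bound t))
  open ForcedA {k} (λ t → s≤s (ψ-bound t)) φ-bound using (forced-a)

  k<n : k < n
  k<n = m<m+n k (s≤s z≤n)

  φk≡k : φ k ≡ k
  φk≡k = trans (cong (k ⊓_) (m+n∸n≡m k k)) (⊓-idem k)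

  toℕ-rotate-low : ∀ i → toℕ i < k → toℕ (rotate k i) ≡ toℕ i + k
  toℕ-rotate-low i i<k = trans (toℕ-rotate k i) (m<n⇒m%n≡m (+-monoˡ-< k i<k))

  -- Since `i + k = (i - k) + n`, the wrap carries the upper half to the lower, so every antipodal
  -- pair has an index below `k`.
  toℕ-rotate-high : ∀ i → k ≤ toℕ i → toℕ (rotate k i) < k
  toℕ-rotate-high i k≤i = begin-strict
    toℕ (rotate k i)            ≡⟨ toℕ-rotate k i ⟩
    (toℕ i + k) % n             ≡⟨ cong (λ z → (z + k) % n) (sym (m∸n+n≡m k≤i)) ⟩
    (toℕ i ∸ k + k + k) % n     ≡⟨ cong (_% n) (+-assoc (toℕ i ∸ k) k k) ⟩
    (toℕ i ∸ k + n) % n         ≡⟨ [m+n]%n≡m%n (toℕ i ∸ k) n ⟩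
    (toℕ i ∸ k) % n             ≡⟨ m<n⇒m%n≡m (<-trans i∸k<k k<n) ⟩
    toℕ i ∸ k                   <⟨ i∸k<k ⟩
    k                           ∎
    where
    open ≤-Reasoning
    i∸k<k : toℕ i ∸ k < k
    i∸k<k = m<n+o⇒m∸n<o (toℕ i) k (toℕ<n i)

  low : Fin k → Fin n
  low i = inject≤ i (<⇒≤ k<n)

  toℕ-low : ∀ i → toℕ (low i) ≡ toℕ i
  toℕ-low i = toℕ-inject≤ i (<⇒≤ k<n)

  toℕ-low<k : ∀ i → toℕ (low i) < k
  toℕ-low<k i = subst (_< k) (sym (toℕ-low i)) (toℕ<n i)

  low-injective : ∀ {i j} → low i ≡ low j → i ≡ j
  low-injective {i} {j} = inject≤-injective (<⇒≤ k<n) (<⇒≤ k<n) i j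

  low-a : List (SVertex n)
  low-a = tabulate (a ∘ low)

  basis : List (SVertex n)
  basis = all-d ++ low-a

  basis-unique : Unique basis
  basis-unique = ++⁺ all-d-unique (tabulate⁺ (low-injective ∘ a-injective)) disjoint
    where
    disjoint : ∀ {v} → ¬ (v ∈ all-d × v ∈ low-a)
    disjoint (v∈d , v∈a) with ∈-tabulate⁻ {f = d} v∈d | ∈-tabulate⁻ {f = a ∘ low} v∈a
    ... | _ , refl | _ , ()

  basis-length : length basis ≡ n + k
  basis-length = trans (length-++ all-d {low-a})
    (cong₂ _+_ {x = length all-d} {y = n} (length-tabulate d) (length-tabulate (a ∘ low)))

  low-a∈basis : ∀ i → toℕ i < k → a i ∈ basis
  low-a∈basis i i<k = ∈-++⁺ʳ all-d (subst (λ z → a z ∈ low-a) low-i (∈-tabulate⁺ {f = a ∘ low} (fromℕ< i<k)))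
    where
    low-i : low (fromℕ< i<k) ≡ i
    low-i = toℕ-injective (trans (toℕ-low (fromℕ< i<k)) (toℕ-fromℕ< i<k))

  half-unique : ∀ t → t + t ≡ n → t ≡ k
  half-unique t eq = *-cancelˡ-≡ t k 2 (trans (sym (k+k≡2k t)) (trans eq (k+k≡2k k)))

  a-dist : ∀ i j → IsDist G (a i) (a j) (φ (offset i j))
  a-dist i j = A.around i j , λ _ → toA-≤

  resolving : IsStrongResolvingSet G basis
  resolving u v u≢v with d-resolves u v u≢v
  ... | inj₁ (w , r) = d w , ∈-++⁺ˡ (∈-tabulate⁺ {f = d} w) , r
  ... | inj₂ (i , j , refl , refl , 2t≡n) with toℕ i <? k
  -- Whichever endpoint has its index below `k` is in `basis` and resolves the pair by the empty
  -- walk.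
  ...   | yes i<k = a i , low-a∈basis i i<k , inj₁ (walks⇒OnGeodesic (a-dist j i) (A.around j i) [])
  ...   | no  i≮k = a j , low-a∈basis j j<k , inj₂ (walks⇒OnGeodesic (a-dist i j) (A.around i j) [])
    where
    rotate-i : rotate k i ≡ j
    rotate-i = trans (cong (λ t → rotate t i) (sym (half-unique (offset i j) 2t≡n))) (rotate-offset i j)
    j<k : toℕ j < k
    j<k = subst (λ z → toℕ z < k) rotate-i (toℕ-rotate-high i (≮⇒≥ i≮k))

  -- The d's are paired with b's: the a's at offset `k` are equally far from them, but would meet
  -- the antipodal pairs.
  Pair : Fin n ⊎ Fin k → SVertex n → Set
  Pair (inj₁ i) x = x ≡ b i ⊎ x ≡ d (rotate k i)
  Pair (inj₂ i) x = x ≡ a (low i) ⊎ x ≡ a (rotate k (low i))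

  -- The two sides lie in different halves. This separates the two a's of one pair and rules out
  -- crosswise overlap of two pairs.
  low≢rotate : ∀ i j → low i ≢ rotate k (low j)
  low≢rotate i j eq = <⇒≱ (toℕ-low<k i) (begin
    k                      ≤⟨ m≤n+m k (toℕ (low j)) ⟩
    toℕ (low j) + k        ≡⟨ sym (toℕ-rotate-low (low j) (toℕ-low<k j)) ⟩
    toℕ (rotate k (low j)) ≡⟨ cong toℕ (sym eq) ⟩
    toℕ (low i)            ∎)
    where open ≤-Reasoning

  pairs-disjoint : ∀ {s t x} → Pair s x → Pair t x → s ≡ t
  pairs-disjoint {inj₁ i} {inj₁ j} (inj₁ refl) (inj₁ eq) = cong inj₁ (b-injective eq)
  pairs-disjoint {inj₁ i} {inj₁ j} (inj₂ refl) (inj₂ eq) = cong inj₁ (rotate-injective (<⇒≤ k<n) (d-injective eq))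
  pairs-disjoint {inj₁ i} {inj₂ j} (inj₁ refl) (inj₁ ())
  pairs-disjoint {inj₁ i} {inj₂ j} (inj₁ refl) (inj₂ ())
  pairs-disjoint {inj₁ i} {inj₂ j} (inj₂ refl) (inj₁ ())
  pairs-disjoint {inj₁ i} {inj₂ j} (inj₂ refl) (inj₂ ())
  pairs-disjoint {inj₂ i} {inj₁ j} (inj₁ refl) (inj₁ ())
  pairs-disjoint {inj₂ i} {inj₁ j} (inj₁ refl) (inj₂ ())
  pairs-disjoint {inj₂ i} {inj₁ j} (inj₂ refl) (inj₁ ())
  pairs-disjoint {inj₂ i} {inj₁ j} (inj₂ refl) (inj₂ ())
  pairs-disjoint {inj₂ i} {inj₂ j} (inj₁ refl) (inj₁ eq) = cong inj₂ (low-injective (a-injective eq))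
  pairs-disjoint {inj₂ i} {inj₂ j} (inj₁ refl) (inj₂ eq) = contradiction (a-injective eq) (low≢rotate i j)
  pairs-disjoint {inj₂ i} {inj₂ j} (inj₂ refl) (inj₁ eq) = contradiction (sym (a-injective eq)) (low≢rotate j i)
  pairs-disjoint {inj₂ i} {inj₂ j} (inj₂ refl) (inj₂ eq) =
    cong inj₂ (low-injective (rotate-injective (<⇒≤ k<n) (a-injective eq)))

  φ-antipode : ∀ i → φ (offset i (rotate k i)) ≡ k
  φ-antipode i = trans (cong φ (offset-rotate i k<n)) φk≡k

  hit : ∀ {xs} → IsStrongResolvingSet G xs → ∀ s → ∃[ x ] (x ∈ xs × Pair s x)
  hit res (inj₁ i) with w , w∈ , r ← res (b i) (d (rotate k i)) (λ ()) =
    w , w∈ , forced-d (cong (2 +_) (φ-antipode i)) r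
  hit res (inj₂ i) with w , w∈ , r ← res (a (low i)) (a (rotate k (low i))) (low≢rotate i i ∘ a-injective) =
    w , w∈ , forced-a (φ-antipode (low i)) r

  sdim : IsSdim G (n + k)
  sdim = (basis , basis-unique , resolving , basis-length)
       -- `splitAt n` merges the two families into one indexed by `Fin (n + k)`.
       , λ xs _ res → disjoint-hits⇒≤ xs (Pair ∘ splitAt n)
           (λ p q → splitAt-injective n (pairs-disjoint p q)) (hit res ∘ splitAt n)

-- Parity and the value `3n / 2`.

double∣ : ∀ k → 2 ∣ (k + k)
double∣ k = divides k (trans (k+k≡2k k) (*-comm 2 k))

odd⇒1+double : ∀ n → ¬ (2 ∣ n) → ∃[ k ] (n ≡ suc (k + k))
odd⇒1+double zero          2∤n = contradiction (double∣ 0) 2∤n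
odd⇒1+double (suc zero)    _   = 0 , refl
odd⇒1+double (suc (suc n)) 2∤n with k , refl ← odd⇒1+double n (λ { (divides q refl) → 2∤n (divides (suc q) refl) }) =
  suc k , cong (suc ∘ suc) (sym (+-suc k k))

three-halves : ∀ k → (3 * (k + k)) / 2 ≡ (k + k) + k
three-halves k = begin
  (3 * (k + k)) / 2       ≡⟨ cong (_/ 2) (identity k) ⟩
  (((k + k) + k) * 2) / 2 ≡⟨ m*n/n≡m ((k + k) + k) 2 ⟩
  (k + k) + k             ∎
  where
  open ≡-Reasoning
  identity : ∀ k → 3 * (k + k) ≡ ((k + k) + k) * 2
  identity = solve-∀

sdim-double : ∀ k (n≥3 : 3 ≤ k + k) → IsSdim (S (k + k) n≥3) ((3 * (k + k)) / 2)
-- `k = 0` is excluded by `n≥3`.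
sdim-double (suc h) n≥3 = subst (IsSdim (S _ n≥3)) (sym (three-halves (suc h))) (Even.sdim h n≥3)

theorem3p2 : (n : ℕ) (n≥3 : 3 ≤ n) →
    (¬ (2 ∣ n) → IsSdim (S n n≥3) n) × (2 ∣ n → IsSdim (S n n≥3) ((3 * n) / 2))
theorem3p2 n n≥3 = odd , even
  where
  odd : ¬ (2 ∣ n) → IsSdim (S n n≥3) n
  odd 2∤n with k , refl ← odd⇒1+double n 2∤n = Odd.sdim k n≥3

  even : 2 ∣ n → IsSdim (S n n≥3) ((3 * n) / 2)
  -- Divisibility gives `k * 2`, which is turned into the sum `k + k` before it replaces `n`.
  even (divides k n≡k*2) with refl ← trans n≡k*2 (trans (*-comm k 2) (sym (k+k≡2k k))) =
    sdim-double k n≥3
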